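{- Let $d \ge 2$ be an integer, let $R_1, R_2$ be two non-empty families of partitions of $[d]$, and let $c(d)=3^{ -2^{d+1}}$. If $R_2 \nprec R_1$, then for every field $\mathbb{F}$ and every positive integer $n$ there exists an order-$d$ tensor $T:[n]^d\to\mathbb{F}$ whose $R_2$-rank is equal to $1$ but whose $R_1$-rank is at least $n^{c(d)}$.
   Context: $[d]=\{1,\dots,d\}$; the parts of a partition are non-empty. $\mathbb{F}$ is an arbitrary field. For positive integers $n_1,\dots,n_d$, an order-$d$ tensor is a function $T:[n_1]\times\dots\times[n_d]\to\mathbb{F}$. For $x\in[n_1]\times\dots\times[n_d]$ and $J\subset[d]$, $x(J)\in\prod_{j\in J}[n_j]$ denotes the restriction of $x$ to its coordinates in $J$. $R$-rank: let $R$ be a non-empty family of partitions of $[d]$. An order-$d$ tensor $T$ has $R$-rank at most $1$ if there exist a partition $P\in R$ and, for each $J\in P$, a function $a_J:\prod_{j\in J}[n_j]\to\mathbb{F}$ such that $T(x)=\prod_{J\in P}a_J(x(J))$ for all $x$. The $R$-rank of $T$ is the smallest nonnegative integer $k$ such that $T=T_1+\dots+T_k$ for some order-$d$ tensors $T_1,\dots,T_k$ each of $R$-rank at most $1$ (the partition used may differ from one $T_i$ to another; the zero tensor has $R$-rank $0$). Finer: for partitions $P_1,P_2$ of $[d]$, $P_2\prec P_1$ ($P_2$ is finer than $P_1$) if for every $J_2\in P_2$ there is $J_1\in P_1$ with $J_2\subset J_1$. For non-empty families $R_1,R_2$ of partitions of $[d]$, $R_2\prec R_1$ if for every $P_2\in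 R_2$ there exists $P_1\in R_1$ with $P_2\prec P_1$; $R_2\nprec R_1$ means that this fails. -}

module Defs where

open import Algebra.Apartness.Bundles using (HeytingField; HeytingCommutativeRing)
open import Algebra.Bundles using (CommutativeRing)
import Algebra.Properties.CommutativeMonoid.Sum as Sum
open import Data.Fin.Base using (Fin)
open import Data.Fin.Subset using (Subset; inside; outside; ∣_∣; _∈_; _⊆_; _∩_; Nonempty; Empty)
open import Data.List.Base using (List; foldr)
open import Data.List.NonEmpty.Base using (List⁺; toList)
open import Data.List.Relation.Unary.All as All using (All)
open import Data.List.Relation.Unary.AllPairs using (AllPairs)
open import Data.List.Relation.Unary.Any using (Any)
open import Data.Nat.Base using (ℕ; _≤_; _^_)
open import Data.Product.Base using (Σ-syntax; _×_)
open import Data.Vec.Base using (Vec; []; _∷_)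
open import Data.Vec.Relation.Unary.All as Vec using ([]; _∷_)
open import Level using (_⊔_)

record Partition (d : ℕ) : Set where
  field
    parts    : List (Subset d)
    nonempty : All Nonempty parts
    disjoint : AllPairs (λ I J → Empty (I ∩ J)) parts
    covering : ∀ i → Any (i ∈_) parts

open Partition public

-- There are finitely many partitions of [d], so a family is given by listing
-- its members; order and repetitions play no role below.
Family : ℕ → Set
Family d = List⁺ (Partition d)

infix 4 _≺_ _≺ᶠ_

_≺_ : ∀ {d} → Partition d → Partition d → Set
P₂ ≺ P₁ = All (λ J₂ → Any (λ J₁ → J₂ ⊆ J₁) (parts P₁)) (parts P₂)

_≺ᶠ_ : ∀ {d} → Family d → Family d → Set
R₂ ≺ᶠ R₁ = All (λ P₂ → Any (λ P₁ → P₂ ≺ P₁) (toList R₁)) (toList R₂)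

-- The product [n₁] × ⋯ × [n_d].  Tuples are first-order data rather than
-- functions, so that propositional equality of tuples is pointwise equality.
Index : ∀ {d} → Vec ℕ d → Set
Index = Vec.All Fin

-- dims ns J lists the n_j with j ∈ J in increasing order of j, so that
-- Index (dims ns J) is the product of the [n_j] over j ∈ J.
dims : ∀ {d} → Vec ℕ d → (J : Subset d) → Vec ℕ ∣ J ∣
dims []       []            = []
dims (n ∷ ns) (inside  ∷ J) = n ∷ dims ns J
dims (n ∷ ns) (outside ∷ J) = dims ns J

restrict : ∀ {d} {ns : Vec ℕ d} → Index ns → (J : Subset d) → Index (dims ns J)
restrict []       []            = []
restrict (i ∷ is) (inside  ∷ J) = i ∷ restrict is J
restrict (i ∷ is) (outside ∷ J) = restrict is J

-- The library's notion of field is the Heyting field; when equality is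
-- decidable this is an ordinary field, with x # y meaning ¬ x ≈ y
-- (1 # 0 follows from invertible⇒#).
module _ {c ℓ₁ ℓ₂} (F : HeytingField c ℓ₁ ℓ₂) where

  open HeytingField F using (Carrier; _≈_; _*_; 1#; heytingCommutativeRing)
  open HeytingCommutativeRing heytingCommutativeRing using (commutativeRing)
  open CommutativeRing commutativeRing using (+-commutativeMonoid)
  open Sum +-commutativeMonoid using (sum)

  Tensor : ∀ {d} → Vec ℕ d → Set c
  Tensor ns = Index ns → Carrier

  module _ {d} {ns : Vec ℕ d} where

    productOver : (P : Partition d) → All (λ J → Tensor (dims ns J)) (parts P) → Tensor ns
    productOver P a x = foldr _*_ 1# (All.reduce (λ {J} aJ → aJ (restrict x J)) a)

    RankAtMostOne : Family d → Tensor ns → Set (c ⊔ ℓ₁)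
    RankAtMostOne R T =
      Any (λ P → Σ[ a ∈ All (λ J → Tensor (dims ns J)) (parts P) ]
                   (∀ x → T x ≈ productOver P a x))
          (toList R)

    SumOfRankAtMostOne : Family d → Tensor ns → ℕ → Set (c ⊔ ℓ₁)
    SumOfRankAtMostOne R T k =
      Σ[ Ts ∈ (Fin k → Tensor ns) ]
        (∀ i → RankAtMostOne R (Ts i)) × (∀ x → T x ≈ sum (λ i → Ts i x))

    IsRank : Family d → Tensor ns → ℕ → Set (c ⊔ ℓ₁)
    IsRank R T r =
      SumOfRankAtMostOne R T r × (∀ k → SumOfRankAtMostOne R T k → r ≤ k)

    -- The R-rank of T is at least the real number n^(1/q), for q ≥ 1.  Being the
    -- least k for which T is a sum of k tensors of R-rank at most 1, the rank is
    -- ≥ n^(1/q) exactly when all such k are, and k ≥ n^(1/q) means n ≤ k^q.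
    -- Quantifying over all such k avoids assuming that a least one can be
    -- found constructively.
    RankAtLeastRoot : Family d → Tensor ns → (n q : ℕ) → Set (c ⊔ ℓ₁)
    RankAtLeastRoot R T n q = ∀ k → SumOfRankAtMostOne R T k → n ≤ k ^ q

{-# OPTIONS --safe #-}
module Submission where

-- Fix P₂ ∈ R₂ finer than no member of R₁.  Give every pair (a , b) of distinct
-- elements of a common part of P₂ a digit of its own, and let T be the product
-- over these edges of the identity matrices coupling that digit of x_a with
-- that digit of x_b.  A tensor of R₁-rank at most 1 is f(x(I)) g(x(Iᶜ)) for
-- some I separating the endpoints of an edge.  If an edge digit has more
-- values p than there are functionals p ↦ f(p , rest) coming from K summands,
-- contracting the source digit with a vector in their common kernel kills all
-- summands that separate this edge, and leaves the product of the remaining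
-- identity matrices.  Contracting the largest digit first exhausts all
-- summands, so T is not a sum of K of them.  If M is the number of joint values
-- of the smaller digits, K M² functionals have to be killed, so that the new
-- number of joint values is (1 + K M²) M: this is where the powers of 3 come
-- from.  When n is too small to store digits for K = 1, it only matters that
-- the R₁-rank is not 1, and T couples the x_a themselves.

open import Defs
open import Algebra.Apartness.Bundles using (HeytingField; HeytingCommutativeRing)
import Algebra.Apartness.Properties.HeytingCommutativeRing as HeytingProperties
open import Algebra.Bundles using (CommutativeRing)
import Algebra.Definitions
import Algebra.Properties.CommutativeSemigroup as CommutativeSemigroup
import Algebra.Properties.Ring as RingProperties
import Algebra.Properties.Semiring.Sum as SemiringSum
open import Data.Bool.Base using (Bool; true; false; not; if_then_else_; _xor_)
import Data.Bool.Properties as Bool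
open import Data.Empty using (⊥)
open import Data.Fin.Base using (Fin; zero; suc; punchIn; combine; remQuot; splitAt; _↑ˡ_)
import Data.Fin.Properties as Fin
open import Data.Fin.Subset using (Subset; inside; outside; _∈_; _⊆_; _∩_; Empty)
open import Data.Fin.Subset.Properties using (_∈?_; _⊆?_; x∈p∩q⁺; x∈p∩q⁻)
open import Data.List.Base
  using (List; []; _∷_; length; map; allFin; cartesianProduct; cartesianProductWith; filter; foldr)
import Data.List.Membership.Propositional as List
open import Data.List.Membership.Propositional.Properties
  using (∈-allFin; ∈-cartesianProduct⁺; ∈-cartesianProductWith⁺; ∈-filter⁺)
open import Data.List.NonEmpty.Base using (head; toList)
open import Data.List.Properties using (length-map; length-++; length-tabulate; length-filter)
open import Data.List.Relation.Unary.All as All using (All; []; _∷_)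
import Data.List.Relation.Unary.All.Properties as All
open import Data.List.Relation.Unary.AllPairs using (AllPairs; []; _∷_)
open import Data.List.Relation.Unary.Any as Any using (Any; here; there)
open import Data.Maybe.Base using (Maybe; just; nothing)
open import Data.Nat.Base as ℕ using (ℕ; zero; suc; s≤s; z≤n; _≤_; _<_; _^_)
import Data.Nat.Properties as ℕ
open import Data.Nat.Solver using (module +-*-Solver)
open import Data.Product.Base using (Σ-syntax; ∃; _×_; _,_; proj₁; proj₂; swap)
open import Data.Sum.Base using ([_,_]′)
open import Data.Unit.Base using (⊤; tt)
open import Data.Vec.Base as Vec using (Vec; []; _∷_; replicate; lookup)
open import Data.Vec.Functional using (insertAt)
open import Data.Vec.Functional.Properties using (insertAt-lookup; insertAt-punchIn)
open import Data.Vec.Properties using ([]=⇒lookup; lookup⇒[]=)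
open import Data.Vec.Relation.Unary.All as VecAll using ([]; _∷_)
import Data.Vec.Relation.Unary.All.Properties as VecAll
import Data.Vec.Relation.Unary.Any as VecAny
import Data.Vec.Relation.Unary.Any.Properties as VecAny
open import Function.Base using (_∘_; const)
open import Level using (_⊔_)
open import Relation.Binary.PropositionalEquality as ≡ using (_≡_; _≢_)
import Relation.Binary.Reasoning.Setoid as ≈-Reasoning
open import Relation.Nullary.Decidable
  using (Dec; yes; no; does; ¬?; _×-dec_; _→-dec_; ¬¬-excluded-middle)
open import Relation.Nullary.Negation using (¬_; contradiction)

-- Points, that is, pairs of digits on all edges, and their number

length-cartesianProductWith : ∀ {a b c} {A : Set a} {B : Set b} {C : Set c} (f : A → B → C) xs ys →
                              length (cartesianProductWith f xs ys) ≡ length xs ℕ.* length ys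
length-cartesianProductWith f []       ys = ≡.refl
length-cartesianProductWith f (x ∷ xs) ys = ≡.trans
  (length-++ (map (f x) ys))
  (≡.cong₂ ℕ._+_ (length-map (f x) ys) (length-cartesianProductWith f xs ys))

-- The source and the target digit of each edge vary independently here; `δ` below is the condition
-- that they coincide.
Point : ∀ {L} → Vec ℕ L → Set
Point = VecAll.All (λ n → Fin n × Fin n)

points : ∀ {L} (ns : Vec ℕ L) → List (Point ns)
points []       = [] ∷ []
points (n ∷ ns) = cartesianProductWith _∷_ (cartesianProduct (allFin n) (allFin n)) (points ns)

∈-points : ∀ {L} {ns : Vec ℕ L} (z : Point ns) → z List.∈ points ns
∈-points []            = Any.here ≡.refl
∈-points ((p , q) ∷ z) =
  ∈-cartesianProductWith⁺ _∷_ (∈-cartesianProduct⁺ (∈-allFin p) (∈-allFin q)) (∈-points z)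

length-points : ∀ {L} n (ns : Vec ℕ L) →
                length (points (n ∷ ns)) ≡ n ℕ.* n ℕ.* length (points ns)
length-points n ns = ≡.trans
  (length-cartesianProductWith _∷_ (cartesianProduct (allFin n) (allFin n)) (points ns))
  (≡.cong (ℕ._* length (points ns)) (≡.trans
    (length-cartesianProductWith _,_ (allFin n) (allFin n))
    (≡.cong₂ ℕ._*_ (length-tabulate {n = n} (λ i → i)) (length-tabulate {n = n} (λ i → i)))))

-- Each digit has more values than K summands impose conditions on it, one for
-- every value of the source and target digits of the remaining edges.
sizes : ℕ → ∀ L → Vec ℕ L
sizes K zero    = []
sizes K (suc L) = suc (K ℕ.* length (points (sizes K L))) ∷ sizes K L

-- A cut records, for each edge, on which side the source and the target digit
-- lie; Agree b s z z′ says that z and z′ agree on the digits of side b.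
Agree : ∀ {L} {ns : Vec ℕ L} → Bool → Vec (Bool × Bool) L → Point ns → Point ns → Set
Agree b []            []            []              = ⊤
Agree b ((u , v) ∷ s) ((p , q) ∷ z) ((p′ , q′) ∷ z′) =
  (u ≡ b → p ≡ p′) × (v ≡ b → q ≡ q′) × Agree b s z z′

Agree-refl : ∀ {L} {ns : Vec ℕ L} {b s} {z : Point ns} → Agree b s z z
Agree-refl {s = []}    {[]}    = tt
Agree-refl {s = _ ∷ _} {_ ∷ _} = (λ _ → ≡.refl) , (λ _ → ≡.refl) , Agree-refl

-- Packing several digits into one coordinate

volume : ∀ {L} → Vec ℕ L → ℕ
volume []       = 1
volume (n ∷ ns) = n ℕ.* volume ns

length-points≡volume² : ∀ {L} (ns : Vec ℕ L) → length (points ns) ≡ volume ns ℕ.* volume ns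
length-points≡volume² []       = ≡.refl
length-points≡volume² (n ∷ ns) = ≡.trans (length-points n ns)
  (≡.trans (≡.cong (n ℕ.* n ℕ.*_) (length-points≡volume² ns))
           (solve 2 (λ n v → n :* n :* (v :* v) := n :* v :* (n :* v)) ≡.refl n (volume ns)))
  where open +-*-Solver

encode : ∀ {L} {ns : Vec ℕ L} → Index ns → Fin (volume ns)
encode []      = zero
encode (i ∷ x) = combine i (encode x)

decode : ∀ {L} (ns : Vec ℕ L) → Fin (volume ns) → Index ns
decode []       _ = []
decode (n ∷ ns) i = let q , r = remQuot {n} (volume ns) i in q ∷ decode ns r

decode-encode : ∀ {L} {ns : Vec ℕ L} (x : Index ns) → decode ns (encode x) ≡ x
decode-encode []      = ≡.refl
decode-encode {ns = n ∷ ns} (i ∷ x) = ≡.trans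
  (≡.cong (λ qr → proj₁ qr ∷ decode ns (proj₂ qr)) (Fin.remQuot-combine i (encode x)))
  (≡.cong (i ∷_) (decode-encode x))

-- One-sided, since `n` may exceed `volume ns`: the tensor reads digits through `back` on all of
-- `Fin n`, while the lower bound only evaluates it on the image of `into`.
record Retract {L} (ns : Vec ℕ L) (n : ℕ) : Set where
  field
    into      : Index ns → Fin n
    back      : Fin n → Index ns
    back-into : ∀ x → back (into x) ≡ x

retract : ∀ {L} {ns : Vec ℕ L} {n} → Index ns → volume ns ≤ n → Retract ns n
retract {ns = ns} o vol≤n with ℕ.m≤n⇒∃[o]m+o≡n vol≤n
... | e , ≡.refl = record
  { into      = λ x → encode x ↑ˡ e
  ; back      = λ i → [ decode ns , const o ]′ (splitAt (volume ns) i)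
  ; back-into = λ x → ≡.trans (≡.cong [ decode ns , const o ]′ (Fin.splitAt-↑ˡ (volume ns) (encode x) e))
                              (decode-encode x)
  }

origin : ∀ K L → Index (sizes K L)
origin K zero    = []
origin K (suc L) = zero ∷ origin K L

-- Growth of the volumes

volume-sizes≥1 : ∀ K L → 1 ≤ volume (sizes K L)
volume-sizes≥1 K zero    = ℕ.≤-refl
volume-sizes≥1 K (suc L) =
  ℕ.*-mono-≤ {1} {suc (K ℕ.* length (points (sizes K L)))} (s≤s z≤n) (volume-sizes≥1 K L)

K<volume-sizes : ∀ K L → K < volume (sizes K (suc L))
K<volume-sizes K L = ℕ.≤-trans (ℕ.≤-reflexive (≡.sym (ℕ.*-identityʳ (suc K))))
  (ℕ.*-mono-≤ (s≤s (ℕ.≤-trans (ℕ.≤-reflexive (≡.sym (ℕ.*-identityʳ K)))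
                               (ℕ.*-monoʳ-≤ K points≥1)))
              (volume-sizes≥1 K L))
  where
  points≥1 : 1 ≤ length (points (sizes K L))
  points≥1 = ≡.subst (1 ≤_) (≡.sym (length-points≡volume² (sizes K L)))
               (ℕ.*-mono-≤ (volume-sizes≥1 K L) (volume-sizes≥1 K L))

-- The extra factor `k` closes the induction: (1 + K M²) M is at most (1 + K) M³ ≤ k² M³, and k
-- times this is (M k)³, so each edge triples the exponent.
volume-sizes-bound : ∀ {K k} → suc K ≤ k ℕ.* k → ∀ L → volume (sizes K L) ℕ.* k ≤ k ^ (3 ^ L)
volume-sizes-bound {K} {k} K<k² zero    = ℕ.≤-reflexive (ℕ.*-comm 1 k)
volume-sizes-bound {K} {k} K<k² (suc L) = begin
  suc (K ℕ.* length (points (sizes K L))) ℕ.* M ℕ.* k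
    ≡⟨ ≡.cong (λ p → suc (K ℕ.* p) ℕ.* M ℕ.* k) (length-points≡volume² (sizes K L)) ⟩
  suc (K ℕ.* (M ℕ.* M)) ℕ.* M ℕ.* k
    ≤⟨ ℕ.*-monoˡ-≤ k (ℕ.*-monoˡ-≤ M (ℕ.+-monoˡ-≤ (K ℕ.* (M ℕ.* M)) (ℕ.*-mono-≤ M≥1 M≥1))) ⟩
  suc K ℕ.* (M ℕ.* M) ℕ.* M ℕ.* k
    ≤⟨ ℕ.*-monoˡ-≤ k (ℕ.*-monoˡ-≤ M (ℕ.*-monoˡ-≤ (M ℕ.* M) K<k²)) ⟩
  k ℕ.* k ℕ.* (M ℕ.* M) ℕ.* M ℕ.* k
    ≡⟨ solve 2 (λ k M → k :* k :* (M :* M) :* M :* k := (M :* k) :^ 3) ≡.refl k M ⟩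
  (M ℕ.* k) ^ 3
    ≤⟨ ℕ.^-monoˡ-≤ 3 (volume-sizes-bound {K} K<k² L) ⟩
  (k ^ (3 ^ L)) ^ 3
    ≡⟨ ℕ.^-*-assoc k (3 ^ L) 3 ⟩
  k ^ (3 ^ L ℕ.* 3)
    ≡⟨ ≡.cong (k ^_) (ℕ.*-comm (3 ^ L) 3) ⟩
  k ^ (3 ^ suc L) ∎
  where
  open ℕ.≤-Reasoning
  open +-*-Solver
  M = volume (sizes K L)
  M≥1 = volume-sizes≥1 K L

d²≤2^[1+d] : ∀ d → d ℕ.* d ≤ 2 ^ suc d
d²≤2^[1+d] 0 = z≤n
d²≤2^[1+d] 1 = ℕ.m≤m+n 1 3
d²≤2^[1+d] 2 = ℕ.m≤m+n 4 4
d²≤2^[1+d] 3 = ℕ.m≤m+n 9 7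
-- With `d` = 3 + e, the difference 2d² - (d + 1)² is 2 + 4e + e². It is negative for d < 3, hence
-- the four base cases.
d²≤2^[1+d] (suc d@(suc (suc (suc e)))) = begin
  suc d ℕ.* suc d
    ≡⟨ solve 1 (λ d → (con 1 :+ d) :* (con 1 :+ d) := d :* d :+ (con 1 :+ con 2 :* d)) ≡.refl d ⟩
  d ℕ.* d ℕ.+ (1 ℕ.+ 2 ℕ.* d)
    ≤⟨ ℕ.+-monoʳ-≤ (d ℕ.* d) (ℕ.m≤m+n (1 ℕ.+ 2 ℕ.* d) (2 ℕ.+ 4 ℕ.* e ℕ.+ e ℕ.* e)) ⟩
  d ℕ.* d ℕ.+ (1 ℕ.+ 2 ℕ.* d ℕ.+ (2 ℕ.+ 4 ℕ.* e ℕ.+ e ℕ.* e))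
    ≡⟨ solve 1 (λ e → let d = con 3 :+ e in
         d :* d :+ (con 1 :+ con 2 :* d :+ (con 2 :+ con 4 :* e :+ e :* e)) := con 2 :* (d :* d)) ≡.refl e ⟩
  2 ℕ.* (d ℕ.* d)
    ≤⟨ ℕ.*-monoʳ-≤ 2 (d²≤2^[1+d] d) ⟩
  2 ^ suc (suc d) ∎
  where
  open ℕ.≤-Reasoning
  open +-*-Solver

-- Searching downwards, the first value that drops to at most `n` marks the crossing.
consecutive : ∀ (f : ℕ → ℕ) {n} m → f 1 ≤ n → n < f (suc m) →
              ∃ λ K → f (suc K) ≤ n × n < f (suc (suc K))
consecutive f     zero    f1≤n n<f1 = contradiction f1≤n (ℕ.<⇒≱ n<f1)
consecutive f {n} (suc m) f1≤n n<f with f (suc m) ℕ.≤? n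
... | yes f≤n = m , f≤n , n<f
... | no  f≰n = consecutive f m f1≤n (ℕ.≰⇒> f≰n)

-- Coordinates of tensor indices

coord : ∀ {d n} → Index (replicate d n) → Fin d → Fin n
coord {suc d} (i ∷ x) zero    = i
coord {suc d} (i ∷ x) (suc j) = coord x j

tuple : ∀ {d n} → (Fin d → Fin n) → Index (replicate d n)
tuple {zero}  f = []
tuple {suc d} f = f zero ∷ tuple (f ∘ suc)

coord-tuple : ∀ {d n} (f : Fin d → Fin n) j → coord (tuple f) j ≡ f j
coord-tuple f zero    = ≡.refl
coord-tuple f (suc j) = coord-tuple (f ∘ suc) j

restrict-cong : ∀ {d n} (J : Subset d) {x x′ : Index (replicate d n)} →
                (∀ {j} → j ∈ J → coord x j ≡ coord x′ j) → restrict x J ≡ restrict x′ J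
restrict-cong []            {[]}    {[]}    eq = ≡.refl
restrict-cong (inside  ∷ J) {_ ∷ _} {_ ∷ _} eq = ≡.cong₂ _∷_ (eq Vec.here) (restrict-cong J (eq ∘ Vec.there))
restrict-cong (outside ∷ J) {_ ∷ _} {_ ∷ _} eq = restrict-cong J (eq ∘ Vec.there)

-- A section of `restrict`, which lets a function of x(J) be written in terms of the coordinates of
-- a full index.
extend : ∀ {d n} (J : Subset d) → Fin n → Index (dims (replicate d n) J) → Index (replicate d n)
extend []            o []      = []
extend (inside  ∷ J) o (i ∷ y) = i ∷ extend J o y
extend (outside ∷ J) o y       = o ∷ extend J o y

coord-extend : ∀ {d n} {J : Subset d} o (x : Index (replicate d n)) {j} → j ∈ J →
               coord (extend J o (restrict x J)) j ≡ coord x j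
coord-extend o (_ ∷ _) Vec.here = ≡.refl
coord-extend {J = inside  ∷ _} o (_ ∷ x) (Vec.there j∈J) = coord-extend o x j∈J
coord-extend {J = outside ∷ _} o (_ ∷ x) (Vec.there j∈J) = coord-extend o x j∈J

-- Edges inside the parts of a partition

Edge : ℕ → Set
Edge d = Fin d × Fin d

Joined : ∀ {d} → List (Subset d) → Edge d → Set
Joined Js (a , b) = a ≢ b × Any (λ J → a ∈ J × b ∈ J) Js

joined? : ∀ {d} (Js : List (Subset d)) e → Dec (Joined Js e)
joined? Js (a , b) = ¬? (a Fin.≟ b) ×-dec Any.any? (λ J → (a ∈? J) ×-dec (b ∈? J)) Js

-- Both orientations of a pair are listed; the resulting bound d² on their number still lies below
-- 2^(d+1).
edges : ∀ {d} → Partition d → List (Edge d)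
edges {d} P = filter (joined? (parts P)) (cartesianProduct (allFin d) (allFin d))

edges-joined : ∀ {d} (P : Partition d) → All (Joined (parts P)) (edges P)
edges-joined {d} P = All.all-filter (joined? (parts P)) (cartesianProduct (allFin d) (allFin d))

length-edges : ∀ {d} (P : Partition d) → length (edges P) ≤ d ℕ.* d
length-edges {d} P = ℕ.≤-trans
  (length-filter (joined? (parts P)) (cartesianProduct (allFin d) (allFin d)))
  (ℕ.≤-reflexive (≡.trans (length-cartesianProductWith _,_ (allFin d) (allFin d))
    (≡.cong₂ ℕ._*_ (length-tabulate {n = d} (λ i → i)) (length-tabulate {n = d} (λ i → i)))))

SplitBy : ∀ {d} → Subset d → Edge d → Set
SplitBy I (a , b) = lookup I a ≢ lookup I b

⊈⇒∃ : ∀ {d} {J I : Subset d} → ¬ J ⊆ I → ∃ λ j → j ∈ J × ¬ j ∈ I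
⊈⇒∃ {d} {J} {I} J⊈I
  with Fin.¬∀⟶∃¬ d (λ j → j ∈ J → j ∈ I) (λ j → (j ∈? J) →-dec (j ∈? I)) (λ all → J⊈I (λ {j} → all j))
... | j , ¬J⇒I with j ∈? J
... | yes j∈J = j , j∈J , λ j∈I → ¬J⇒I (λ _ → j∈I)
... | no  j∉J = contradiction (λ j∈J → contradiction j∈J j∉J) ¬J⇒I

-- Some part J of `P₂` lies in no part of `P₁`. Take a in J, the part I of `P₁` containing a, and b
-- in J outside I: the edge (a , b) is split by I.
⊀⇒split : ∀ {d} (P₁ P₂ : Partition d) → ¬ (P₂ ≺ P₁) →
          ∃ λ I → I List.∈ parts P₁ × Any (SplitBy I) (edges P₂)
⊀⇒split P₁ P₂ P₂⊀P₁
  with List.find (All.¬All⇒Any¬ (λ J → Any.any? (J ⊆?_) (parts P₁)) (parts P₂) P₂⊀P₁)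
... | J , J∈P₂ , J⊈P₁ with All.lookup (nonempty P₂) J∈P₂
... | a , a∈J with List.find (covering P₁ a)
... | I , I∈P₁ , a∈I with ⊈⇒∃ (All.lookup (All.¬Any⇒All¬ (parts P₁) J⊈P₁) I∈P₁)
... | b , b∈J , b∉I = I , I∈P₁ , List.lose edge∈ split
  where
  edge∈ : (a , b) List.∈ edges P₂
  edge∈ = ∈-filter⁺ (joined? (parts P₂)) (∈-cartesianProduct⁺ (∈-allFin a) (∈-allFin b))
    ((λ { ≡.refl → b∉I a∈I }) , List.lose J∈P₂ (a∈J , b∈J))

  split : SplitBy I (a , b)
  split eq = b∉I (lookup⇒[]= b I (≡.trans (≡.sym eq) ([]=⇒lookup a∈I)))

-- Digits stored at a vertex

module _ {d : ℕ} where

  -- Vertices outside an edge get the fixed digit o there: this is what makes the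
  -- digits of j independent of the far side of a cut.
  digits : ∀ {L} {ns : Vec ℕ L} → Index ns → Vec (Edge d) L → Point ns → Fin d → Index ns
  digits []       []             []            j = []
  digits (o ∷ os) ((a , b) ∷ es) ((p , q) ∷ z) j =
    (if does (j Fin.≟ a) then p else if does (j Fin.≟ b) then q else o) ∷ digits os es z j

  digit-source : ∀ {L} {ns : Vec ℕ L} os (es : Vec (Edge d) L) (z : Point ns) l →
                 VecAll.lookup⁺ (digits os es z (proj₁ (lookup es l))) l ≡ proj₁ (VecAll.lookup⁺ z l)
  digit-source (o ∷ os) ((a , b) ∷ es) ((p , q) ∷ z) zero with a Fin.≟ a
  ... | yes _   = ≡.refl
  ... | no a≢a = contradiction ≡.refl a≢a
  digit-source (o ∷ os) (_ ∷ es) (_ ∷ z) (suc l) = digit-source os es z l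

  -- `digits` tests for the source first, so on a loop the source digit would hide the target digit.
  digit-target : ∀ {L} {ns : Vec ℕ L} os (es : Vec (Edge d) L) (z : Point ns) l →
                 proj₁ (lookup es l) ≢ proj₂ (lookup es l) →
                 VecAll.lookup⁺ (digits os es z (proj₂ (lookup es l))) l ≡ proj₂ (VecAll.lookup⁺ z l)
  digit-target (o ∷ os) ((a , b) ∷ es) ((p , q) ∷ z) zero a≢b with b Fin.≟ a | b Fin.≟ b
  ... | yes b≡a | _      = contradiction (≡.sym b≡a) a≢b
  ... | no _    | yes _  = ≡.refl
  ... | no _    | no b≢b = contradiction ≡.refl b≢b
  digit-target (o ∷ os) (_ ∷ es) (_ ∷ z) (suc l) = digit-target os es z l

  cutBy : ∀ {L} → Subset d → Vec (Edge d) L → Vec (Bool × Bool) L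
  cutBy I = Vec.map (λ (a , b) → lookup I a , lookup I b)

  -- A vertex on side `b` reads a digit of an edge only as an endpoint of it, and then that digit
  -- lies on side `b` too.
  digits-local : ∀ {L} {ns : Vec ℕ L} os (es : Vec (Edge d) L) I b {z z′ : Point ns} →
                 Agree b (cutBy I es) z z′ → ∀ {j} → lookup I j ≡ b →
                 digits os es z j ≡ digits os es z′ j
  digits-local []       []             I s {[]}    {[]}    _                   _    = ≡.refl
  digits-local (o ∷ os) ((a , b) ∷ es) I s {_ ∷ _} {_ ∷ _} (p≡p′ , q≡q′ , ag) {j} eq =
    ≡.cong₂ _∷_ first (digits-local os es I s ag eq)
    where
    first : (if does (j Fin.≟ a) then _ else if does (j Fin.≟ b) then _ else o) ≡
            (if does (j Fin.≟ a) then _ else if does (j Fin.≟ b) then _ else o)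
    first with j Fin.≟ a | j Fin.≟ b
    ... | yes ≡.refl | _          = p≡p′ eq
    ... | no _       | yes ≡.refl = q≡q′ eq
    ... | no _       | no _       = ≡.refl

-- Separated edges from the failure of refinement, and the final estimate

Separated : ∀ {d L} → Vec (Edge d) L → Partition d → Set
Separated es P = ∃ λ I → I List.∈ parts P × VecAny.Any (SplitBy I) es

_≺?_ : ∀ {d} (P₂ P₁ : Partition d) → Dec (P₂ ≺ P₁)
P₂ ≺? P₁ = All.all? (λ J → Any.any? (J ⊆?_) (parts P₁)) (parts P₂)

⊀ᶠ⇒separated : ∀ {d} (R₁ R₂ : Family d) → ¬ (R₂ ≺ᶠ R₁) →
  Σ[ P ∈ Partition d ] P List.∈ toList R₂ × All (Separated (Vec.fromList (edges P))) (toList R₁)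
⊀ᶠ⇒separated R₁ R₂ R₂⊀R₁
  with List.find (All.¬All⇒Any¬ (λ P₂ → Any.any? (P₂ ≺?_) (toList R₁)) (toList R₂) R₂⊀R₁)
... | P₂ , P₂∈R₂ , P₂⊀R₁ = P₂ , P₂∈R₂ ,
  All.map (λ {P₁} → separate {P₁}) (All.¬Any⇒All¬ (toList R₁) P₂⊀R₁)
  where
  separate : ∀ {P₁} → ¬ P₂ ≺ P₁ → Separated (Vec.fromList (edges P₂)) P₁
  separate {P₁} P₂⊀P₁ = let I , I∈P₁ , split = ⊀⇒split P₁ P₂ P₂⊀P₁ in I , I∈P₁ , VecAny.fromList⁺ split

-- For a `K` whose digits no longer fit into `n`: 1 + K ≤ 2k ≤ k² makes `volume-sizes-bound`
-- applicable.
<volume⇒≤k^ : ∀ K {k n} L d → 2 ≤ k → K ≤ k → L ≤ d ℕ.* d → n < volume (sizes K L) →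
              n ≤ k ^ (3 ^ (2 ^ suc d))
<volume⇒≤k^ K {k@(suc _)} {n} L d 2≤k K≤k L≤d² n<vol = begin
  n                                ≤⟨ ℕ.<⇒≤ n<vol ⟩
  volume (sizes K L)               ≤⟨ ℕ.m≤m*n (volume (sizes K L)) k ⟩
  volume (sizes K L) ℕ.* k         ≤⟨ volume-sizes-bound 1+K≤k² L ⟩
  k ^ (3 ^ L)                      ≤⟨ ℕ.^-monoʳ-≤ k (ℕ.^-monoʳ-≤ 3 (ℕ.≤-trans L≤d² (d²≤2^[1+d] d))) ⟩
  k ^ (3 ^ (2 ^ suc d))            ∎
  where
  open ℕ.≤-Reasoning
  1+K≤k² : suc K ≤ k ℕ.* k
  1+K≤k² = begin
    1 ℕ.+ K         ≤⟨ ℕ.+-mono-≤ (s≤s z≤n) K≤k ⟩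
    k ℕ.+ k         ≡⟨ ≡.cong (k ℕ.+_) (ℕ.+-identityʳ k) ⟨
    2 ℕ.* k         ≤⟨ ℕ.*-monoˡ-≤ k 2≤k ⟩
    k ℕ.* k         ∎

-- A split edge exists, so `L` is positive; without edges the volume would be 1 for every `K`.
separated⇒K<volume : ∀ {d L} {es : Vec (Edge d) L} {P} → Separated es P → ∀ K → K < volume (sizes K L)
separated⇒K<volume {L = suc L} _ K = K<volume-sizes K L

module _ {c ℓ₁ ℓ₂} (F : HeytingField c ℓ₁ ℓ₂) where

  open HeytingField F using (_#_; tight; #⇒invertible; heytingCommutativeRing)
  open HeytingCommutativeRing heytingCommutativeRing using (commutativeRing)
  open CommutativeRing commutativeRing hiding (zero)
  open SemiringSum semiring
  open HeytingProperties heytingCommutativeRing using (1#0; x-0≈x)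
  open RingProperties ring using (-‿distribˡ-*)
  open CommutativeSemigroup *-commutativeSemigroup using (xy∙z≈xz∙y; x∙yz≈y∙xz; interchange)
  open Algebra.Definitions _≈_ using (Invertible)
  open ≈-Reasoning setoid

  1≉0 : ¬ 1# ≈ 0#
  1≉0 1≈0 = proj₂ (tight 1# 0#) 1≈0 1#0

  sum≈0 : ∀ {n} {f : Fin n → Carrier} → (∀ i → f i ≈ 0#) → sum f ≈ 0#
  sum≈0 {n} f≈0 = trans (sum-cong-≋ f≈0) (sum-replicate-zero n)

  -- Linear algebra

  ⟪_,_⟫ : ∀ {n} → (Fin n → Carrier) → (Fin n → Carrier) → Carrier
  ⟪ w , φ ⟫ = sum (λ p → w p * φ p)

  ⟪⟫-cong : ∀ {n} (w : Fin n → Carrier) {φ ψ : Fin n → Carrier} →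
            (∀ i → φ i ≈ ψ i) → ⟪ w , φ ⟫ ≈ ⟪ w , ψ ⟫
  ⟪⟫-cong {n} w φ≈ψ = sum-cong-≋ {n} (λ i → *-congˡ (φ≈ψ i))

  ⟪⟫-zero : ∀ {n} (w : Fin n → Carrier) {φ : Fin n → Carrier} →
            (∀ i → φ i ≈ 0#) → ⟪ w , φ ⟫ ≈ 0#
  ⟪⟫-zero w φ≈0 = sum≈0 (λ i → trans (*-congˡ (φ≈0 i)) (zeroʳ (w i)))

  ⟪⟫-linear : ∀ {n} (w φ ψ : Fin n → Carrier) a →
              ⟪ w , (λ i → ψ i + a * φ i) ⟫ ≈ ⟪ w , ψ ⟫ + a * ⟪ w , φ ⟫
  ⟪⟫-linear {n} w φ ψ a = begin
    ⟪ w , (λ i → ψ i + a * φ i) ⟫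
      ≈⟨ sum-cong-≋ {n} (λ i → trans (distribˡ (w i) (ψ i) _) (+-congˡ (x∙yz≈y∙xz (w i) a (φ i)))) ⟩
    sum {n} (λ i → w i * ψ i + a * (w i * φ i))
      ≈⟨ ∑-distrib-+ {n} _ _ ⟩
    ⟪ w , ψ ⟫ + sum {n} (λ i → a * (w i * φ i))
      ≈⟨ +-congˡ (*-distribˡ-sum {n} a _) ⟨
    ⟪ w , ψ ⟫ + a * ⟪ w , φ ⟫ ∎

  ⟪⟫-sum : ∀ {n k} (w : Fin n → Carrier) (f : Fin n → Fin k → Carrier) →
           ⟪ w , (λ p → sum (f p)) ⟫ ≈ sum (λ i → ⟪ w , (λ p → f p i) ⟫)
  ⟪⟫-sum {n} {k} w f =
    trans (sum-cong-≋ {n} (λ p → *-distribˡ-sum {k} (w p) (f p)))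
          (∑-comm {n} {k} (λ p i → w p * f p i))

  ⟪⟫-insertAt : ∀ {n} (w : Fin n → Carrier) p a (φ : Fin (suc n) → Carrier) →
                ⟪ insertAt w p a , φ ⟫ ≈ ⟪ w , φ ∘ punchIn p ⟫ + a * φ p
  ⟪⟫-insertAt w p a φ = begin
    ⟪ insertAt w p a , φ ⟫
      ≈⟨ sum-remove {i = p} (λ i → insertAt w p a i * φ i) ⟩
    insertAt w p a p * φ p + sum (λ i → insertAt w p a (punchIn p i) * φ (punchIn p i))
      ≈⟨ +-cong (*-congʳ (reflexive (insertAt-lookup w p a)))
                (sum-cong-≋ (λ i → *-congʳ (reflexive (insertAt-punchIn w p a i)))) ⟩
    a * φ p + ⟪ w , φ ∘ punchIn p ⟫
      ≈⟨ +-comm _ _ ⟩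
    ⟪ w , φ ∘ punchIn p ⟫ + a * φ p ∎

  -- The vector is nonzero in normalised form: with the target digit fixed at `s`, contracting an
  -- identity matrix gives exactly 1.
  Kernel : ∀ {n} → List (Fin n → Carrier) → Set (c ⊔ ℓ₁)
  Kernel {n} φs = Σ[ w ∈ (Fin n → Carrier) ] Σ[ s ∈ Fin n ]
                    w s ≈ 1# × All (λ φ → ⟪ w , φ ⟫ ≈ 0#) φs

  -- Gaussian elimination needs to decide whether entries vanish, hence the
  -- double negation.  The bound m is what the recursion descends on, as
  -- map reduce φs is not a subterm.
  kernel : ∀ m {n} (φs : List (Fin n → Carrier)) → length φs ≤ m → m < n → ¬ ¬ Kernel φs
  kernel m       {suc n} []       _         _         ¬ker =
    ¬ker ((λ _ → 1#) , zero , refl , [])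
  kernel (suc m) {suc n} (φ ∷ φs) (s≤s len) (s≤s m<n) ¬ker = ¬¬-excluded-middle λ
    -- If no entry of `φ` is apart from 0, all entries are 0 by tightness and `φ` imposes no
    -- condition.
    { (no φ#0̸) → kernel m φs len (ℕ.m<n⇒m<1+n m<n) λ { (w , s , ws≈1 , w⊥φs) →
        ¬ker (w , s , ws≈1 , ⟪⟫-zero w (λ p → proj₁ (tight _ _) (λ φp#0 → φ#0̸ (p , φp#0))) ∷ w⊥φs) }
    ; (yes (p , φp#0)) → eliminate p (#⇒invertible φp#0)
    }
    where
    eliminate : ∀ p → Invertible 1# _*_ (φ p - 0#) → ⊥
    eliminate p (v , vφp≈1 , _) =
      kernel m (map reduce φs) (≡.subst (_≤ m) (≡.sym (length-map reduce φs)) len) m<n λ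
        { (w , s , ws≈1 , w⊥) →
          -- The entry at the pivot `p` is the solution of the equation given by `φ`, as `u` is the
          -- negated inverse of `φ p`.
          ¬ker ( insertAt w p (u * ⟪ w , φ ∘ punchIn p ⟫)
               , punchIn p s
               , trans (reflexive (insertAt-punchIn w p _ s)) ws≈1
               , trans (⟪⟫-insertAt w p _ φ) (pivot w)
                 ∷ All.map (λ {ψ} w⊥ψ → trans (⟪⟫-insertAt w p _ ψ) (trans (other w ψ) w⊥ψ)) (All.map⁻ w⊥)) }
      where
      u : Carrier
      u = - v

      -- Adds the multiple of `φ` that cancels the entry of `ψ` at `p`, then drops this entry.
      reduce : (Fin (suc n) → Carrier) → Fin n → Carrier
      reduce ψ i = ψ (punchIn p i) + (u * ψ p) * φ (punchIn p i)

      uφp≈-1 : u * φ p ≈ - 1#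
      uφp≈-1 = trans (sym (-‿distribˡ-* v (φ p)))
                     (-‿cong (trans (*-congˡ (sym (x-0≈x (φ p)))) vφp≈1))

      pivot : ∀ w → let S = ⟪ w , φ ∘ punchIn p ⟫ in S + (u * S) * φ p ≈ 0#
      pivot w = begin
        S + (u * S) * φ p   ≈⟨ +-congˡ (trans (xy∙z≈xz∙y u S (φ p)) (*-congʳ uφp≈-1)) ⟩
        S + - 1# * S        ≈⟨ +-congʳ (*-identityˡ S) ⟨
        1# * S + - 1# * S   ≈⟨ distribʳ S 1# (- 1#) ⟨
        (1# - 1#) * S       ≈⟨ *-congʳ (-‿inverseʳ 1#) ⟩
        0# * S              ≈⟨ zeroˡ S ⟩
        0#                  ∎
        where S = ⟪ w , φ ∘ punchIn p ⟫

      other : ∀ w ψ → ⟪ w , ψ ∘ punchIn p ⟫ + (u * ⟪ w , φ ∘ punchIn p ⟫) * ψ p ≈ ⟪ w , reduce ψ ⟫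
      other w ψ = trans (+-congˡ (xy∙z≈xz∙y u _ (ψ p)))
        (sym (⟪⟫-linear w (φ ∘ punchIn p) (ψ ∘ punchIn p) (u * ψ p)))

  -- Contracting products of identity matrices

  δ : ∀ {L} {ns : Vec ℕ L} → Point ns → Carrier
  δ []            = 1#
  δ ((p , q) ∷ z) = if does (p Fin.≟ q) then δ z else 0#

  -- A summand f(x(I)) g(x(Iᶜ)) as seen on digits. The invariant `split`, a separated edge among
  -- those remaining, cannot hold once no edge is left.
  record SplitProduct {L} (ns : Vec ℕ L) : Set (c ⊔ ℓ₁) where
    field
      cut    : Vec (Bool × Bool) L
      factor : Bool → Point ns → Carrier
      local  : ∀ b {z z′} → Agree b cut z z′ → factor b z ≈ factor b z′
      split  : VecAny.Any (λ (u , v) → u ≢ v) cut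

    value : Point ns → Carrier
    value z = factor true z * factor false z

    value-by : ∀ u z → value z ≈ factor u z * factor (not u) z
    value-by true  z = refl
    value-by false z = *-comm _ _

  -- Summands killed by a contraction are kept as nothing, so that the number of
  -- summands never changes.
  value? : ∀ {L} {ns : Vec ℕ L} → Maybe (SplitProduct ns) → Point ns → Carrier
  value? nothing  z = 0#
  value? (just t) z = SplitProduct.value t z

  ⟪⟫-product : ∀ {n} (w A B : Fin n → Carrier) {A′ : Fin n → Carrier} {b} →
               (∀ p → A p ≈ A′ p) → (∀ p → B p ≈ b) →
               ⟪ w , (λ p → A p * B p) ⟫ ≈ ⟪ w , A′ ⟫ * b
  ⟪⟫-product {n} w A B {A′} {b} A≈A′ B≈b = begin
    ⟪ w , (λ p → A p * B p) ⟫
      ≈⟨ sum-cong-≋ {n} (λ p → trans (*-congˡ (*-cong (A≈A′ p) (B≈b p))) (sym (*-assoc _ _ _))) ⟩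
    sum {n} (λ p → (w p * A′ p) * b)
      ≈⟨ *-distribʳ-sum {n} b _ ⟨
    ⟪ w , A′ ⟫ * b ∎

  -- If the first edge is split, the factor seeing its source digit does not see
  -- its target digit, so the latter may be filled in arbitrarily, here with p.
  constraint : ∀ {L n} {ns : Vec ℕ L} → Maybe (SplitProduct (n ∷ ns)) → Point ns → Fin n → Carrier
  constraint nothing  z p = 0#
  constraint (just t) z p = SplitProduct.factor t (proj₁ (Vec.head (SplitProduct.cut t))) ((p , p) ∷ z)

  module _ {L n : ℕ} {ns : Vec ℕ L} (w : Fin n → Carrier) (s : Fin n) where

    Contraction : Maybe (SplitProduct (n ∷ ns)) → Set (c ⊔ ℓ₁)
    Contraction t = Σ[ t′ ∈ Maybe (SplitProduct ns) ]
                      ∀ z → ⟪ w , (λ p → value? t ((p , s) ∷ z)) ⟫ ≈ value? t′ z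

    -- If the first edge is split, only one factor depends on `p`, and `w` annihilates it. Otherwise
    -- both digits lie on one side, whose factor absorbs the contraction, and the split edge is a
    -- later one.
    contract : ∀ t → (∀ z → ⟪ w , constraint t z ⟫ ≈ 0#) → Contraction t
    contract nothing _ = nothing , λ z → ⟪⟫-zero w (λ _ → refl)
    contract (just t@record { cut = (u , v) ∷ cs ; factor = f ; local = loc ; split = spl }) w⊥t
      with u Bool.≟ v
    ... | no u≢v = nothing , λ z → begin
      ⟪ w , (λ p → SplitProduct.value t ((p , s) ∷ z)) ⟫
        ≈⟨ ⟪⟫-cong w (λ p → SplitProduct.value-by t u ((p , s) ∷ z)) ⟩
      ⟪ w , (λ p → f u ((p , s) ∷ z) * f (not u) ((p , s) ∷ z)) ⟫
        ≈⟨ ⟪⟫-product w _ _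
             (λ p → loc u ((λ _ → ≡.refl) , (λ v≡u → contradiction (≡.sym v≡u) u≢v) , Agree-refl))
             (λ p → loc (not u)
               ((λ u≡¬u → contradiction u≡¬u (Bool.not-¬ ≡.refl)) , (λ _ → ≡.refl) , Agree-refl)) ⟩
      ⟪ w , (λ p → f u ((p , p) ∷ z)) ⟫ * f (not u) ((s , s) ∷ z)
        ≈⟨ *-congʳ (w⊥t z) ⟩
      0# * f (not u) ((s , s) ∷ z)
        ≈⟨ zeroˡ _ ⟩
      0# ∎
    ... | yes ≡.refl = just t′ , λ z → begin
      ⟪ w , (λ p → SplitProduct.value t ((p , s) ∷ z)) ⟫
        ≈⟨ ⟪⟫-cong w (λ p → SplitProduct.value-by t u ((p , s) ∷ z)) ⟩
      ⟪ w , (λ p → f u ((p , s) ∷ z) * f (not u) ((p , s) ∷ z)) ⟫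
        ≈⟨ ⟪⟫-product w _ _ (λ _ → refl)
             (λ p → loc (not u)
               ((λ u≡¬u → contradiction u≡¬u (Bool.not-¬ ≡.refl)) , (λ _ → ≡.refl) , Agree-refl)) ⟩
      ⟪ w , (λ p → f u ((p , s) ∷ z)) ⟫ * f (not u) ((s , s) ∷ z)
        ≈⟨ value-t′ u z ⟩
      SplitProduct.value t′ z ∎
      where
      -- `u xor b` is false exactly when `b` is the side of the two digits. The other factor sees
      -- neither of them, so `s` serves as a filler.
      f′ : Bool → Bool → Point ns → Carrier
      f′ u b z = if u xor b then f b ((s , s) ∷ z) else ⟪ w , (λ p → f b ((p , s) ∷ z)) ⟫

      local′ : ∀ b {z z′} → Agree b cs z z′ → f′ u b z ≈ f′ u b z′
      local′ b ag with u xor b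
      ... | true  = loc b ((λ _ → ≡.refl) , (λ _ → ≡.refl) , ag)
      ... | false = ⟪⟫-cong w (λ p → loc b ((λ _ → ≡.refl) , (λ _ → ≡.refl) , ag))

      t′ : SplitProduct ns
      t′ = record
        { cut    = cs
        ; factor = f′ u
        ; local  = local′
        ; split  = VecAny.tail (λ u≢u → u≢u ≡.refl) spl
        }

      value-t′ : ∀ u z → ⟪ w , (λ p → f u ((p , s) ∷ z)) ⟫ * f (not u) ((s , s) ∷ z)
                       ≈ f′ u true z * f′ u false z
      value-t′ true  z = refl
      value-t′ false z = *-comm _ _

  -- Only the term p = s survives, with weight 1.
  δ-contract : ∀ {L n} {ns : Vec ℕ L} (w : Fin n → Carrier) s → w s ≈ 1# → (z : Point ns) →
               δ z ≈ ⟪ w , (λ p → δ ((p , s) ∷ z)) ⟫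
  δ-contract {n = suc n} w s ws≈1 z = sym (begin
    ⟪ w , (λ p → δ ((p , s) ∷ z)) ⟫
      ≈⟨ sum-remove {i = s} (λ p → w p * δ ((p , s) ∷ z)) ⟩
    w s * δ ((s , s) ∷ z) + sum (λ i → w (punchIn s i) * δ ((punchIn s i , s) ∷ z))
      ≈⟨ +-cong (*-cong ws≈1 diagonal) (sum≈0 (λ i → trans (*-congˡ (off-diagonal i)) (zeroʳ _))) ⟩
    1# * δ z + 0#
      ≈⟨ trans (+-identityʳ _) (*-identityˡ _) ⟩
    δ z ∎)
    where
    diagonal : δ ((s , s) ∷ z) ≈ δ z
    diagonal with s Fin.≟ s
    ... | yes _   = refl
    ... | no s≢s = contradiction ≡.refl s≢s

    off-diagonal : ∀ i → δ ((punchIn s i , s) ∷ z) ≈ 0#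
    off-diagonal i with punchIn s i Fin.≟ s
    ... | yes eq = contradiction eq (Fin.punchInᵢ≢i s i)
    ... | no _   = refl

  -- A negation is proved, so the doubly negated `kernel` suffices. Without edges every summand is
  -- `nothing`, and the empty product 1 would be 0.
  δ-not-sum : ∀ {K k} → k ≤ K → ∀ L (ts : Fin k → Maybe (SplitProduct (sizes K L))) →
              ¬ (∀ z → δ z ≈ sum (λ i → value? (ts i) z))
  δ-not-sum {k = k} k≤K zero    ts δ≈ = 1≉0 (trans (δ≈ []) (sum≈0 (λ i → value≈0 (ts i))))
    where
    value≈0 : ∀ t → value? t [] ≈ 0#
    value≈0 nothing = refl
    value≈0 (just record { cut = [] ; split = () })
  δ-not-sum {K} {k} k≤K (suc L) ts δ≈ = kernel _ constraints few ℕ.≤-refl λ { (w , s , ws≈1 , w⊥) →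
    let contracted i = contract w s (ts i) λ z → All.lookup w⊥
          (∈-cartesianProductWith⁺ (λ i → constraint (ts i)) (∈-allFin i) (∈-points z))
    in δ-not-sum k≤K L (proj₁ ∘ contracted) λ z → begin
      δ z
        ≈⟨ δ-contract w s ws≈1 z ⟩
      ⟪ w , (λ p → δ ((p , s) ∷ z)) ⟫
        ≈⟨ ⟪⟫-cong w (λ p → δ≈ ((p , s) ∷ z)) ⟩
      ⟪ w , (λ p → sum (λ i → value? (ts i) ((p , s) ∷ z))) ⟫
        ≈⟨ ⟪⟫-sum w (λ p i → value? (ts i) ((p , s) ∷ z)) ⟩
      sum (λ i → ⟪ w , (λ p → value? (ts i) ((p , s) ∷ z)) ⟫)
        ≈⟨ sum-cong-≋ (λ i → proj₂ (contracted i) z) ⟩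
      sum (λ i → value? (proj₁ (contracted i)) z) ∎ }
    where
    ns = sizes K L

    constraints : List (Fin (suc (K ℕ.* length (points ns))) → Carrier)
    constraints = cartesianProductWith (λ i → constraint (ts i)) (allFin k) (points ns)

    few : length constraints ≤ K ℕ.* length (points ns)
    few = ℕ.≤-trans
      (ℕ.≤-reflexive (≡.trans
        (length-cartesianProductWith (λ i → constraint (ts i)) (allFin k) (points ns))
        (≡.cong (ℕ._* length (points ns)) (length-tabulate {n = k} (λ i → i)))))
      (ℕ.*-monoˡ-≤ (length (points ns)) k≤K)

  -- Tensors built from edges

  -- `productOver` for any list of subsets, to allow recursion on the list.
  factors : ∀ {d n} {Js : List (Subset d)} → All (λ J → Tensor F (dims (replicate d n) J)) Js →
            Index (replicate d n) → Carrier
  factors a x = foldr _*_ 1# (All.reduce (λ {J} aJ → aJ (restrict x J)) a)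

  -- The factorisation f(x(I)) g(x(Iᶜ)). Both sides take the whole index and satisfy a locality
  -- condition, so no restriction to a complement has to be formed.
  record CutProduct {d n} (I : Subset d) (T : Tensor F (replicate d n)) : Set (c ⊔ ℓ₁) where
    field
      side  : Bool → Tensor F (replicate d n)
      value : ∀ x → T x ≈ side true x * side false x
      local : ∀ b {x x′} → (∀ {j} → lookup I j ≡ b → coord x j ≡ coord x′ j) → side b x ≡ side b x′

  disjoint⇒outside : ∀ {d} {I J : Subset d} → Empty (I ∩ J) → ∀ {j} → j ∈ J → lookup I j ≡ false
  disjoint⇒outside {I = I} I∩J≡∅ {j} j∈J with lookup I j in eq
  ... | false = ≡.refl
  ... | true  = contradiction (j , x∈p∩q⁺ (lookup⇒[]= j I eq , j∈J)) I∩J≡∅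

  factors-local : ∀ {d n} {I : Subset d} {Js} → All (λ J → Empty (I ∩ J)) Js →
                  (a : All (λ J → Tensor F (dims (replicate d n) J)) Js) → ∀ {x x′} →
                  (∀ {j} → lookup I j ≡ false → coord x j ≡ coord x′ j) → factors a x ≡ factors a x′
  factors-local _          []      eq = ≡.refl
  factors-local {I = I} (disj ∷ disjs) (_∷_ {x = J} aJ a) eq =
    ≡.cong₂ _*_ (≡.cong aJ (restrict-cong J (λ j∈J → eq (disjoint⇒outside disj j∈J))))
                (factors-local disjs a eq)

  -- The factor of `I` is one side; all other parts are disjoint from `I` and together form the
  -- other.
  factors-cut : ∀ {d n} {I : Subset d} {Js} → AllPairs (λ I J → Empty (I ∩ J)) Js → I List.∈ Js →
                (a : All (λ J → Tensor F (dims (replicate d n) J)) Js) → CutProduct I (factors a)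
  factors-cut {I = I} (disj ∷ _) (here ≡.refl) (aI ∷ a) = record
    { side  = λ { true x → aI (restrict x I) ; false x → factors a x }
    ; value = λ x → refl
    ; local = λ { true  eq → ≡.cong aI (restrict-cong I (eq ∘ []=⇒lookup))
                ; false eq → factors-local disj a eq }
    }
  factors-cut {I = I} (disj ∷ disjs) (there I∈Js) (_∷_ {x = J} aJ a) = record
    { side  = λ { true x → side true x ; false x → aJ (restrict x J) * side false x }
    ; value = λ x → trans (*-congˡ (value x)) (x∙yz≈y∙xz _ _ _)
    ; local = λ { true  eq → local true eq
                ; false eq → ≡.cong₂ _*_
                    (≡.cong aJ (restrict-cong J (λ j∈J → eq (disjoint⇒outside I∩J≡∅ j∈J))))
                    (local false eq) }
    }
    where
    open CutProduct (factors-cut disjs I∈Js a)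
    I∩J≡∅ : Empty (I ∩ J)
    I∩J≡∅ (i , i∈I∩J) = All.lookup disj I∈Js (i , x∈p∩q⁺ (swap (x∈p∩q⁻ I J i∈I∩J)))

  indicator : ∀ {p} {P : Set p} → Dec P → Carrier
  indicator P? = if does P? then 1# else 0#

  indicator≈1 : ∀ {p} {P : Set p} (P? : Dec P) → P → indicator P? ≈ 1#
  indicator≈1 (yes _) _ = refl
  indicator≈1 (no ¬p) p = contradiction p ¬p

  indicator≈0 : ∀ {p} {P : Set p} (P? : Dec P) → ¬ P → indicator P? ≈ 0#
  indicator≈0 (no _)  _  = refl
  indicator≈0 (yes p) ¬p = contradiction p ¬p

  -- `E` is a parameter because it compares single digits when `n` is large and whole coordinates
  -- when `n` is small.
  module EdgeTensor {d n L : ℕ} (es : Vec (Edge d) L) (E : Fin L → Fin n → Fin n → Set)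
                    (E? : ∀ l i j → Dec (E l i j)) (o : Fin n) where

    Matches : Index (replicate d n) → Fin L → Set
    Matches x l = E l (coord x (proj₁ (lookup es l))) (coord x (proj₂ (lookup es l)))

    -- Only edges with both ends in `J` are tested, so the padding `o` in `blocks` never matters.
    Consistent : Subset d → Index (replicate d n) → Set
    Consistent J x = ∀ l → proj₁ (lookup es l) ∈ J → proj₂ (lookup es l) ∈ J → Matches x l

    consistent? : ∀ J x → Dec (Consistent J x)
    consistent? J x = Fin.all? λ l → (_ ∈? J) →-dec ((_ ∈? J) →-dec E? l _ _)

    blocks : ∀ Js → All (λ J → Tensor F (dims (replicate d n) J)) Js
    blocks = All.universal (λ J y → indicator (consistent? J (extend J o y)))

    edgeTensor : Partition d → Tensor F (replicate d n)
    edgeTensor P = productOver F P (blocks (parts P))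

    edgeTensor≈1 : ∀ P x → (∀ l → Matches x l) → edgeTensor P x ≈ 1#
    edgeTensor≈1 P x match = go (parts P)
      where
      go : ∀ Js → factors (blocks Js) x ≈ 1#
      go []       = refl
      go (J ∷ Js) = trans (*-cong (indicator≈1 (consistent? J _) consistent) (go Js)) (*-identityˡ 1#)
        where
        consistent : Consistent J (extend J o (restrict x J))
        consistent l a∈J b∈J =
          ≡.subst₂ (E l) (≡.sym (coord-extend o x a∈J)) (≡.sym (coord-extend o x b∈J)) (match l)

    edgeTensor≈0 : ∀ P x l → Joined (parts P) (lookup es l) → ¬ Matches x l → edgeTensor P x ≈ 0#
    edgeTensor≈0 P x l (_ , joined) mismatch = go (parts P) joined
      where
      go : ∀ Js → Any (λ J → proj₁ (lookup es l) ∈ J × proj₂ (lookup es l) ∈ J) Js →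
           factors (blocks Js) x ≈ 0#
      go (J ∷ Js) (here (a∈J , b∈J)) = trans (*-congʳ (indicator≈0 (consistent? J _) inconsistent)) (zeroˡ _)
        where
        inconsistent : ¬ Consistent J (extend J o (restrict x J))
        inconsistent con = mismatch
          (≡.subst₂ (E l) (coord-extend o x a∈J) (coord-extend o x b∈J) (con l a∈J b∈J))
      go (J ∷ Js) (there i) = trans (*-congˡ (go Js i)) (zeroʳ _)

    -- Shows that the tensor is nonzero and so excludes rank 0.
    constant≈1 : (∀ l i → E l i i) → ∀ P i → edgeTensor P (tuple (const i)) ≈ 1#
    constant≈1 E-refl P i = edgeTensor≈1 P (tuple (const i)) λ l →
      ≡.subst₂ (E l) (≡.sym (coord-tuple {d} (const i) _)) (≡.sym (coord-tuple {d} (const i) _)) (E-refl l i)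

    rank≥1 : (∀ l i → E l i i) → ∀ P R k → SumOfRankAtMostOne F R (edgeTensor P) k → 1 ≤ k
    rank≥1 E-refl P R zero    (_ , _ , T≈0) =
      contradiction (trans (sym (constant≈1 E-refl P o)) (T≈0 (tuple (const o)))) 1≉0
    rank≥1 E-refl P R (suc k) _             = s≤s z≤n

    isRank-1 : (∀ l i → E l i i) → ∀ {P R} → P List.∈ toList R → IsRank F R (edgeTensor P) 1
    isRank-1 E-refl {P} {R} P∈R =
      ( (λ _ → edgeTensor P)
      , (λ _ → Any.map (λ { ≡.refl → blocks (parts P) , λ _ → refl }) P∈R)
      , (λ _ → sym (+-identityʳ _)) )
      , rank≥1 E-refl P R

  -- Lower bounds for the rank of an edge tensor

  δ≈1 : ∀ {L} {ns : Vec ℕ L} (z : Point ns) →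
        (∀ l → proj₁ (VecAll.lookup⁺ z l) ≡ proj₂ (VecAll.lookup⁺ z l)) → δ z ≈ 1#
  δ≈1 []            eq = refl
  δ≈1 ((p , q) ∷ z) eq with p Fin.≟ q
  ... | yes _  = δ≈1 z (eq ∘ suc)
  ... | no p≢q = contradiction (eq zero) p≢q

  δ≈0 : ∀ {L} {ns : Vec ℕ L} (z : Point ns) l →
        proj₁ (VecAll.lookup⁺ z l) ≢ proj₂ (VecAll.lookup⁺ z l) → δ z ≈ 0#
  δ≈0 ((p , q) ∷ z) l ne with p Fin.≟ q
  δ≈0 ((p , q) ∷ z) l       ne | no _    = refl
  δ≈0 ((p , q) ∷ z) zero    ne | yes p≡q = contradiction p≡q ne
  δ≈0 ((p , q) ∷ z) (suc l) ne | yes _   = δ≈0 z l ne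

  rankOne⇒cut : ∀ {d n L} {es : Vec (Edge d) L} {R : Family d} {T : Tensor F (replicate d n)} →
                All (Separated es) (toList R) → RankAtMostOne F R T →
                ∃ λ I → VecAny.Any (SplitBy I) es × CutProduct I T
  rankOne⇒cut seps rank1 with All.lookupAny seps rank1
  ... | (I , I∈P , split) , (a , T≈) = I , split , record
    { side  = side
    ; value = λ x → trans (T≈ x) (value x)
    ; local = local
    }
    where open CutProduct (factors-cut (disjoint (Any.lookup rank1)) I∈P a)

  module _ {d n L : ℕ} (es : Vec (Edge d) L) (P : Partition d)
           (joined : ∀ (l : Fin L) → Joined (parts P) (lookup es l))
           {R : Family d} (separated : All (Separated es) (toList R)) where

    module Large (K : ℕ) (vol≤n : volume (sizes K L) ≤ n) where

      open Retract (retract (origin K L) vol≤n)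

      SameDigit : Fin L → Fin n → Fin n → Set
      SameDigit l i j = VecAll.lookup⁺ (back i) l ≡ VecAll.lookup⁺ (back j) l

      sameDigit? : ∀ l i j → Dec (SameDigit l i j)
      sameDigit? l i j = VecAll.lookup⁺ (back i) l Fin.≟ VecAll.lookup⁺ (back j) l

      open EdgeTensor es SameDigit sameDigit? (into (origin K L)) public

      embed : Point (sizes K L) → Index (replicate d n)
      embed z = tuple (into ∘ digits (origin K L) es z)

      digit-embed : ∀ z l j → VecAll.lookup⁺ (back (coord (embed z) j)) l
                            ≡ VecAll.lookup⁺ (digits (origin K L) es z j) l
      digit-embed z l j = ≡.cong (λ x → VecAll.lookup⁺ x l) (≡.trans
        (≡.cong back (coord-tuple (into ∘ digits (origin K L) es z) j)) (back-into _))

      source : ∀ z l → VecAll.lookup⁺ (back (coord (embed z) (proj₁ (lookup es l)))) l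
                     ≡ proj₁ (VecAll.lookup⁺ z l)
      source z l = ≡.trans (digit-embed z l _) (digit-source (origin K L) es z l)

      target : ∀ z l → VecAll.lookup⁺ (back (coord (embed z) (proj₂ (lookup es l)))) l
                     ≡ proj₂ (VecAll.lookup⁺ z l)
      target z l = ≡.trans (digit-embed z l _) (digit-target (origin K L) es z l (proj₁ (joined l)))

      edgeTensor-embed : ∀ z → edgeTensor P (embed z) ≈ δ z
      edgeTensor-embed z with Fin.all? (λ l → proj₁ (VecAll.lookup⁺ z l) Fin.≟ proj₂ (VecAll.lookup⁺ z l))
      ... | yes diag = trans
        (edgeTensor≈1 P (embed z) (λ l → ≡.trans (source z l) (≡.trans (diag l) (≡.sym (target z l)))))
        (sym (δ≈1 z diag))
      ... | no ¬diag with Fin.¬∀⟶∃¬ L _ (λ l → proj₁ (VecAll.lookup⁺ z l) Fin.≟ proj₂ (VecAll.lookup⁺ z l)) ¬diag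
      ... | l , p≢q = trans
        (edgeTensor≈0 P (embed z) l (joined l)
          (λ eq → p≢q (≡.trans (≡.sym (source z l)) (≡.trans eq (target z l)))))
        (sym (δ≈0 z l p≢q))

      -- Each digit inherits the side of the vertex storing it, so a cut of the vertices becomes a
      -- cut of the digits.
      pullback : ∀ {I T} → VecAny.Any (SplitBy I) es → CutProduct I T →
                 Σ[ t ∈ SplitProduct (sizes K L) ] ∀ z → T (embed z) ≈ SplitProduct.value t z
      pullback {I} split C = record
        { cut    = cutBy I es
        ; factor = λ b z → side b (embed z)
        ; local  = λ b {z} {z′} ag → reflexive (local b (λ {j} eq → ≡.trans
            (coord-tuple (into ∘ digits (origin K L) es z) j)
            (≡.trans (≡.cong into (digits-local (origin K L) es I b ag eq))
                     (≡.sym (coord-tuple (into ∘ digits (origin K L) es z′) j)))))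
        ; split  = VecAny.map⁺ split
        } , λ z → value (embed z)
        where open CutProduct C

      rank>K : ∀ k → SumOfRankAtMostOne F R (edgeTensor P) k → K < k
      rank>K k (Ts , rank1 , T≈) = ℕ.≰⇒> λ k≤K →
        δ-not-sum k≤K L (λ i → just (proj₁ (split i))) λ z → begin
          δ z                                              ≈⟨ edgeTensor-embed z ⟨
          edgeTensor P (embed z)                           ≈⟨ T≈ (embed z) ⟩
          sum {k} (λ i → Ts i (embed z))                   ≈⟨ sum-cong-≋ {k} (λ i → proj₂ (split i) z) ⟩
          sum {k} (λ i → SplitProduct.value (proj₁ (split i)) z) ∎
        where
        split : ∀ i → Σ[ t ∈ SplitProduct (sizes K L) ] ∀ z → Ts i (embed z) ≈ SplitProduct.value t z
        split i with rankOne⇒cut separated (rank1 i)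
        ... | I , split , C = pullback split C

    module Small (o : Fin n) where

      open EdgeTensor es (λ _ → _≡_) (λ _ → Fin._≟_) o public

      -- If the tensor factored along `I`, exchanging the sides of the constant indices `i` and `j`
      -- would preserve the product of their values, which is 1. But the index equal to `i` on `I`
      -- and `j` elsewhere violates a split edge, so its value is 0.
      rank≢1 : ∀ {i j : Fin n} → i ≢ j → ¬ SumOfRankAtMostOne F R (edgeTensor P) 1
      rank≢1 {i} {j} i≢j (Ts , rank1 , T≈) with rankOne⇒cut separated (rank1 zero)
      ... | I , split , C = 1≉0 (begin
        1#                                            ≈⟨ *-identityˡ 1# ⟨
        1# * 1#                                       ≈⟨ *-cong (constant i) (constant j) ⟩
        (A i * B i) * (A j * B j)                     ≈⟨ *-congˡ (*-comm (A j) (B j)) ⟩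
        (A i * B i) * (B j * A j)                     ≈⟨ interchange (A i) (B i) (B j) (A j) ⟩
        (A i * B j) * (B i * A j)                     ≈⟨ *-congʳ mixed ⟩
        0# * (B i * A j)                              ≈⟨ zeroˡ _ ⟩
        0#                                            ∎)
        where
        open CutProduct C

        mix : Fin n → Fin n → Fin d → Fin n
        mix u v m = if lookup I m then u else v

        A B : Fin n → Carrier
        A u = side true  (tuple (mix u u))
        B v = side false (tuple (mix v v))

        mix-value : ∀ u v → edgeTensor P (tuple (mix u v)) ≈ A u * B v
        mix-value u v = begin
          edgeTensor P (tuple (mix u v))                               ≈⟨ trans (T≈ _) (+-identityʳ _) ⟩
          Ts zero (tuple (mix u v))                                    ≈⟨ value _ ⟩
          side true (tuple (mix u v)) * side false (tuple (mix u v))   ≈⟨ *-cong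
            (reflexive (local true  (λ {m} eq → coord-cong m (on-side m eq))))
            (reflexive (local false (λ {m} eq → coord-cong m (off-side m eq)))) ⟩
          A u * B v ∎
          where
          coord-cong : ∀ m {f g : Fin d → Fin n} → f m ≡ g m → coord (tuple f) m ≡ coord (tuple g) m
          coord-cong m {f} {g} eq = ≡.trans (coord-tuple f m) (≡.trans eq (≡.sym (coord-tuple g m)))
          on-side : ∀ m → lookup I m ≡ true → mix u v m ≡ mix u u m
          on-side m eq rewrite eq = ≡.refl
          off-side : ∀ m → lookup I m ≡ false → mix u v m ≡ mix v v m
          off-side m eq rewrite eq = ≡.refl

        constant : ∀ u → 1# ≈ A u * B u
        constant u = trans (sym (edgeTensor≈1 P (tuple (mix u u)) λ l →
            ≡.trans (same _) (≡.sym (same _)))) (mix-value u u)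
          where
          same : ∀ m → coord (tuple (mix u u)) m ≡ u
          same m = ≡.trans (coord-tuple (mix u u) m) (Bool.if-eta (lookup I m))

        mixed : A i * B j ≈ 0#
        mixed = trans (sym (mix-value i j))
          (edgeTensor≈0 P (tuple (mix i j)) l (joined l) λ eq → mix-injective _ _ (VecAny.lookup-index split)
            (≡.trans (≡.sym (coord-tuple (mix i j) _)) (≡.trans eq (coord-tuple (mix i j) _))))
          where
          l = VecAny.index split
          mix-injective : ∀ a b → lookup I a ≢ lookup I b → mix i j a ≢ mix i j b
          mix-injective a b a≢b eq with lookup I a | lookup I b
          ... | true  | true  = a≢b ≡.refl
          ... | true  | false = i≢j eq
          ... | false | true  = i≢j (≡.sym eq)
          ... | false | false = a≢b ≡.refl

  -- Choosing the digit sizes according to `n`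

  module _ {d L : ℕ} {es : Vec (Edge d) L} {P : Partition d}
           (joined : ∀ (l : Fin L) → Joined (parts P) (lookup es l)) (L≤d² : L ≤ d ℕ.* d)
           {R₁ R₂ : Family d} (P∈R₂ : P List.∈ toList R₂)
           (separated : All (Separated es) (toList R₁)) where

    Gap : ℕ → Set _
    Gap n = Σ[ T ∈ Tensor F (replicate d n) ]
              IsRank F R₂ T 1 × RankAtLeastRoot F R₁ T n (3 ^ (2 ^ suc d))

    -- Digits for `suc K` summands fit into `n`, so k ≥ K + 2 for every admissible k; digits for K +
    -- 2 summands do not fit, which bounds `n` by a power of k.
    gap-large : ∀ {n} K → volume (sizes (suc K) L) ≤ n → n < volume (sizes (suc (suc K)) L) → Gap n
    gap-large K vol≤n n<vol = edgeTensor P , isRank-1 (λ _ _ → ≡.refl) P∈R₂ , λ k sum →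
      let K<k = rank>K k sum
      in <volume⇒≤k^ (suc (suc K)) L d (ℕ.≤-trans (s≤s (s≤s z≤n)) K<k) K<k L≤d² n<vol
      where open Large es P joined {R₁} separated (suc K) vol≤n

    gap-small : ∀ n → 1 ≤ n → n < volume (sizes 1 L) → Gap n
    gap-small n@(suc m) _ n<vol = edgeTensor P , isRank-1 (λ _ _ → ≡.refl) P∈R₂ , lower m ≡.refl
      where
      open Small es P joined {R₁} separated (zero {n = m})

      -- The copy `m′` permits distinguishing n = 1, where 1 ≤ 1^q suffices, from n ≥ 2, where two
      -- distinct values exclude k = 1.
      lower : ∀ m′ → m ≡ m′ → RankAtLeastRoot F R₁ (edgeTensor P) n (3 ^ (2 ^ suc d))
      lower _       _      0             sum = contradiction (rank≥1 (λ _ _ → ≡.refl) P R₁ 0 sum) λ ()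
      lower _       _      (suc (suc k)) sum = <volume⇒≤k^ 1 L d (s≤s (s≤s z≤n)) (s≤s z≤n) L≤d² n<vol
      lower zero    ≡.refl 1             sum = ℕ.m^n>0 1 (3 ^ (2 ^ suc d))
      lower (suc _) ≡.refl 1             sum = contradiction sum (rank≢1 {zero} {suc zero} λ ())

    gap : ∀ n → 1 ≤ n → Gap n
    gap n 1≤n with volume (sizes 1 L) ℕ.≤? n
    ... | no vol≰n  = gap-small n 1≤n (ℕ.≰⇒> vol≰n)
    ... | yes vol≤n =
      -- The volume for `suc n` summands exceeds `n`, which gives the search its upper end.
      let K , vol≤n , n<vol = consecutive (λ K → volume (sizes K L)) n vol≤n
            (ℕ.<⇒≤ (separated⇒K<volume {P = head R₁} (All.lookup separated (here ≡.refl)) (suc n)))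
      in gap-large K vol≤n n<vol

corollary1p6 : ∀ (d : ℕ) → 2 ≤ d →
    ∀ (R₁ R₂ : Family d) → ¬ (R₂ ≺ᶠ R₁) →
    ∀ {c ℓ₁ ℓ₂} (F : HeytingField c ℓ₁ ℓ₂) (n : ℕ) → 1 ≤ n →
    Σ[ T ∈ Tensor F (replicate d n) ]
    IsRank F R₂ T 1 × RankAtLeastRoot F R₁ T n (3 ^ (2 ^ suc d))
corollary1p6 d _ R₁ R₂ R₂⊀R₁ F n 1≤n =
  let P , P∈R₂ , separated = ⊀ᶠ⇒separated R₁ R₂ R₂⊀R₁
      joined = VecAll.lookup⁺ (VecAll.fromList⁺ (edges-joined P))
  in gap F joined (length-edges P) P∈R₂ separated n 1≤n
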